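{- Let $G$ be an undirected graph, let $p,q\ge 0$ be two integers, and let $\mu:2^{V(G)}\to \mathbb{Z}_{\ge 0}$ be a monotone function. If every $v\in V(G)$ is contained in some $(\mu,p,q)$-cluster, then $G$ has a $(\mu,p,q)$-partition. Furthermore, given a set of $(\mu,p,q)$-clusters $C_1,\dots,C_n$ whose union is $V(G)$, a $(\mu,p,q)$-partition of $G$ can be found in polynomial time.
   Context: For $X\subseteq V(G)$, $\Delta(X)$ is the set of edges of $G$ between $X$ and $V(G)\setminus X$, and $d(X)=|\Delta(X)|$. A function $\mu:2^{V(G)}\to\mathbb{Z}_{\ge 0}$ is monotone if $\mu(X)\le\mu(Y)$ whenever $X\subseteq Y$. A set $C\subseteq V(G)$ is a $(\mu,p,q)$-cluster if $\mu(C)\le p$ and $d(C)\le q$. A $(\mu,p,q)$-partition of $G$ is a partition of $V(G)$ into $(\mu,p,q)$-clusters. -}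

module Defs where

open import Data.Bool using (Bool; true; false; _xor_)
open import Data.Fin using (Fin; toℕ)
open import Data.Fin.Subset using (Subset; Nonempty; Empty; _∩_; ⋃; ⊤; ∣_∣; _⊆_)
open import Data.List using (List; []; _∷_)
open import Data.List.Relation.Unary.All using (All)
open import Data.List.Relation.Unary.AllPairs using (AllPairs)
open import Data.Nat using (ℕ; zero; suc; _+_; _*_; _^_; _≤_)
open import Data.Product using (Σ; ∃; _×_; _,_)
open import Data.Vec using (Vec; lookup; map; replicate; toList; _[_]≔_)
open import Relation.Binary.PropositionalEquality using (_≡_)

------------------------------------------------------------------------
-- Graphs, clusters and partitions

-- Finite undirected graphs. The order of the two ends of an edge carries no
-- meaning. Parallel edges and loops are not excluded; simple graphs are a
-- special case.
record Graph : Set where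
  field
    order : ℕ
    size  : ℕ
    ends  : Vec (Fin order × Fin order) size

open Graph public

VertexSet : Graph → Set
VertexSet G = Subset (order G)

Δ : (G : Graph) → VertexSet G → Subset (size G)
Δ G X = map (λ (u , v) → lookup X u xor lookup X v) (ends G)

d : (G : Graph) → VertexSet G → ℕ
d G X = ∣ Δ G X ∣

Monotone : ∀ {n} → (Subset n → ℕ) → Set
Monotone μ = ∀ X Y → X ⊆ Y → μ X ≤ μ Y

IsCluster : (G : Graph) (μ : VertexSet G → ℕ) (p q : ℕ) → VertexSet G → Set
IsCluster G μ p q C = μ C ≤ p × d G C ≤ q

Disjoint : ∀ {n} → Subset n → Subset n → Set
Disjoint X Y = Empty (X ∩ Y)

record Partition (G : Graph) (μ : VertexSet G → ℕ) (p q : ℕ) : Set where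
  field
    parts    : List (VertexSet G)
    nonempty : All Nonempty parts
    disjoint : AllPairs Disjoint parts
    covering : ⋃ parts ≡ ⊤
    clusters : All (IsCluster G μ p q) parts

------------------------------------------------------------------------
-- Polynomial time
--
-- The machine model is the WHILE language of N. D. Jones, "Computability and
-- Complexity from a Programming Perspective" (1997), with a primitive
-- conditional: imperative programs over binary trees, with unit cost for each
-- elementary operation. Its polynomial-time class is that of Turing machines.

infixr 5 _∙_

data Tree : Set where
  nil : Tree
  _∙_ : Tree → Tree → Tree

head : Tree → Tree
head nil     = nil
head (l ∙ r) = l

tail : Tree → Tree
tail nil     = nil
tail (l ∙ r) = r

∥_∥ : Tree → ℕ
∥ nil ∥   = 1
∥ l ∙ r ∥ = suc (∥ l ∥ + ∥ r ∥)

data Expr (k : ℕ) : Set where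
  var  : Fin k → Expr k
  nil  : Expr k
  cons : Expr k → Expr k → Expr k
  hd   : Expr k → Expr k
  tl   : Expr k → Expr k

infix  6 _≔_
infixr 5 _⨾_

data Cmd (k : ℕ) : Set where
  _≔_           : Fin k → Expr k → Cmd k
  _⨾_           : Cmd k → Cmd k → Cmd k
  if_then_else_ : Expr k → Cmd k → Cmd k → Cmd k
  while_loop_     : Expr k → Cmd k → Cmd k

Store : ℕ → Set
Store k = Vec Tree k

eval : ∀ {k} → Expr k → Store k → Tree
eval (var x)    σ = lookup σ x
eval nil        σ = nil
eval (cons e f) σ = eval e σ ∙ eval f σ
eval (hd e)     σ = head (eval e σ)
eval (tl e)     σ = tail (eval e σ)

cost : ∀ {k} → Expr k → ℕ
cost (var x)    = 1
cost nil        = 1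
cost (cons e f) = 1 + cost e + cost f
cost (hd e)     = 1 + cost e
cost (tl e)     = 1 + cost e

-- `nil` is false and every other tree is true.
truth : Tree → Bool
truth nil     = false
truth (_ ∙ _) = true

-- c ⊢ σ ⇓[ t ] τ : started in store σ, the command c halts in store τ after
-- t steps.
infix 3 _⊢_⇓[_]_

data _⊢_⇓[_]_ {k : ℕ} : Cmd k → Store k → ℕ → Store k → Set where

  assign : ∀ {x e σ} →
           x ≔ e ⊢ σ ⇓[ 1 + cost e ] (σ [ x ]≔ eval e σ)

  seq : ∀ {c c′ σ τ υ t t′} →
        c  ⊢ σ ⇓[ t ] τ →
        c′ ⊢ τ ⇓[ t′ ] υ →
        c ⨾ c′ ⊢ σ ⇓[ 1 + t + t′ ] υ

  if-true : ∀ {e c c′ σ τ t} →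
            truth (eval e σ) ≡ true →
            c ⊢ σ ⇓[ t ] τ →
            if e then c else c′ ⊢ σ ⇓[ 1 + cost e + t ] τ

  if-false : ∀ {e c c′ σ τ t} →
             truth (eval e σ) ≡ false →
             c′ ⊢ σ ⇓[ t ] τ →
             if e then c else c′ ⊢ σ ⇓[ 1 + cost e + t ] τ

  while-true : ∀ {e c σ τ υ t t′} →
               truth (eval e σ) ≡ true →
               c ⊢ σ ⇓[ t ] τ →
               while e loop c ⊢ τ ⇓[ t′ ] υ →
               while e loop c ⊢ σ ⇓[ 1 + cost e + t + t′ ] υ

  while-false : ∀ {e c σ} →
                truth (eval e σ) ≡ false →
                while e loop c ⊢ σ ⇓[ 1 + cost e ] σ

record Program : Set where
  field
    vars  : ℕ
    read  : Fin vars
    body  : Cmd vars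
    write : Fin vars

-- All variables other than the input variable are initially `nil`.
Computes : Program → Tree → ℕ → Tree → Set
Computes P input t output =
  ∃ λ τ → (body ⊢ (replicate vars nil [ read ]≔ input) ⇓[ t ] τ) ×
          lookup τ write ≡ output
  where open Program P

-- A single program, with a single polynomial time bound in the size of the
-- encoded instance, finds a solution of every instance.
SolvableInPolyTime : (I : Set) → (I → Tree) →
                     (S : I → Set) → (∀ i → S i → Tree) → Set
SolvableInPolyTime I encI S encS =
  ∃ λ (P : Program) → ∃ λ (a : ℕ) → ∃ λ (b : ℕ) →
  ∀ (i : I) → Σ (S i) λ s → ∃ λ t →
    Computes P (encI i) t (encS i s) × t ≤ a * ∥ encI i ∥ ^ b + a

------------------------------------------------------------------------
-- Encodings

encodeList : ∀ {A : Set} → (A → Tree) → List A → Tree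
encodeList f []       = nil
encodeList f (x ∷ xs) = f x ∙ encodeList f xs

encodeBool : Bool → Tree
encodeBool false = nil
encodeBool true  = nil ∙ nil

-- Unary; only used for vertices and for the number of vertices.
encodeℕ : ℕ → Tree
encodeℕ zero    = nil
encodeℕ (suc n) = nil ∙ encodeℕ n

encodeSubset : ∀ {n} → Subset n → Tree
encodeSubset X = encodeList encodeBool (toList X)

encodeGraph : Graph → Tree
encodeGraph G =
  encodeℕ (order G) ∙
  encodeList (λ (u , v) → encodeℕ (toℕ u) ∙ encodeℕ (toℕ v)) (toList (ends G))

------------------------------------------------------------------------
-- The problem of turning a cover by clusters into a partition

record ClusterCover : Set where
  field
    graph    : Graph
    p q      : ℕ
    μ        : VertexSet graph → ℕ
    monotone : Monotone μ
    sets     : List (VertexSet graph)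
    clusters : All (IsCluster graph μ p q) sets
    covering : ⋃ sets ≡ ⊤

-- The algorithm is given the graph and the clusters. It has no access to
-- μ, p and q, so no assumption on the complexity of μ is needed.
encodeCover : ClusterCover → Tree
encodeCover I = encodeGraph graph ∙ encodeList encodeSubset sets
  where open ClusterCover I

PartitionOf : ClusterCover → Set
PartitionOf I = Partition graph μ p q
  where open ClusterCover I

encodePartition : (I : ClusterCover) → PartitionOf I → Tree
encodePartition I 𝒫 = encodeList encodeSubset (Partition.parts 𝒫)

{-# OPTIONS --safe #-}
-- If X and Y are clusters, then so are X ─ Y and Y, or X and Y ─ X: μ is monotone,
-- and d (X ─ Y) + d (Y ─ X) ≤ d X + d Y, so that d (X ─ Y) > d X forces
-- d (Y ─ X) ≤ d Y. Which pair to take is decided by comparing d (X ─ Y) with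
-- d X, without knowing μ, p and q. Uncrossing a set X in this way with the members
-- of a disjoint family one after the other keeps the family disjoint, since sets
-- only shrink; so inserting the given clusters one by one takes a quadratic number
-- of uncrossings.

module Submission where

open import Defs
open import Algebra.Properties.CommutativeSemigroup using (interchange)
open import Data.Bool using (Bool; true; false; T; not; _∧_; _∨_; _xor_) renaming (if_then_else_ to ifᵇ_then_else_)
open import Data.Bool.Properties using (∧-zeroʳ; ∧-identityʳ; ∨-zeroʳ; ∨-identityʳ; ∨-assoc)
open import Data.Fin using (Fin; zero; suc; toℕ)
open import Data.Fin.Properties using (toℕ<n)
open import Data.Fin.Subset using (Subset; Nonempty; _∈_; _∉_; _⊆_; _─_; ⋃; ∣_∣)
open import Data.Fin.Subset.Properties using (nonempty?; _∈?_; ∉⊥; ∈⊤; ⊆⊤; ⊆-antisym; drop-there; ∣p∣≤n;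
  p─q⊆p; x∈p∧x∉q⇒x∈p─q; x∈p∩q⁺; x∈p∩q⁻; x∈p∪q⁺; x∈p∪q⁻)
open import Data.List using (List; []; _∷_; foldl; length; replicate; tabulate; _ʳ++_)
open import Data.List.Properties using (++-identityʳ; length-replicate; length-ʳ++; ʳ++-ʳ++)
open import Data.List.Relation.Unary.All as All using (All; []; _∷_)
open import Data.List.Relation.Unary.All.Properties as All using (tabulate⁺)
open import Data.List.Relation.Unary.AllPairs using (AllPairs; []; _∷_)
open import Data.List.Relation.Unary.Any using (Any; here; there)
open import Data.List.Relation.Unary.Any.Properties as Any using (tabulate⁺)
open import Data.Nat using (ℕ; zero; suc; _+_; _*_; _^_; _∸_; _≤_; _≤ᵇ_; z≤n; s≤s; NonZero)
open import Data.Nat.Properties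
open import Data.Product using (∃; _×_; _,_; proj₁; proj₂; uncurry)
open import Data.Sum using (_⊎_; inj₁; inj₂; [_,_]′)
open import Data.Unit using (⊤; tt)
open import Data.Vec using (Vec; []; _∷_; here; there; lookup; map; toList; _[_]≔_)
open import Data.Vec.Properties using (length-toList)
open import Function using (flip; _∘_; mk⇔)
open import Relation.Binary.PropositionalEquality using (_≡_; refl; sym; trans; cong; cong₂; subst; subst₂)
open import Relation.Nullary using (does; yes; no; contradiction)
open import Relation.Nullary.Decidable using (does-⇔)

-- Uncrossing

Covers : ∀ {n} → List (Subset n) → Set
Covers Xs = ∀ v → Any (v ∈_) Xs

∈-⋃⁻ : ∀ {n} (Xs : List (Subset n)) {v} → v ∈ ⋃ Xs → Any (v ∈_) Xs
∈-⋃⁻ []       v∈⊥ = contradiction v∈⊥ ∉⊥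
∈-⋃⁻ (X ∷ Xs) v∈  = [ here , there ∘ ∈-⋃⁻ Xs ]′ (x∈p∪q⁻ X (⋃ Xs) v∈)

∈-⋃⁺ : ∀ {n} {Xs : List (Subset n)} {v} → Any (v ∈_) Xs → v ∈ ⋃ Xs
∈-⋃⁺ (here v∈X)  = x∈p∪q⁺ (inj₁ v∈X)
∈-⋃⁺ (there v∈Xs) = x∈p∪q⁺ (inj₂ (∈-⋃⁺ v∈Xs))

disjoint-sym : ∀ {n} {X Y : Subset n} → Disjoint X Y → Disjoint Y X
disjoint-sym {X = X} {Y} X#Y (v , v∈) with x∈p∩q⁻ Y X v∈
... | v∈Y , v∈X = X#Y (v , x∈p∩q⁺ (v∈X , v∈Y))

disjoint-⊆ : ∀ {n} {X X′ Y Y′ : Subset n} → X′ ⊆ X → Y′ ⊆ Y → Disjoint X Y → Disjoint X′ Y′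
disjoint-⊆ {X′ = X′} {Y′ = Y′} X′⊆X Y′⊆Y X#Y (v , v∈) with x∈p∩q⁻ X′ Y′ v∈
... | v∈X′ , v∈Y′ = X#Y (v , x∈p∩q⁺ (X′⊆X v∈X′ , Y′⊆Y v∈Y′))

x∈p─q⇒x∉q : ∀ {n} (X Y : Subset n) {v} → v ∈ X ─ Y → v ∉ Y
x∈p─q⇒x∉q (x ∷ X) (false ∷ Y) here       ()
x∈p─q⇒x∉q (x ∷ X) (y ∷ Y)     (there v∈) (there v∈Y) = x∈p─q⇒x∉q X Y v∈ v∈Y

─-disjoint : ∀ {n} (X Y : Subset n) → Disjoint (X ─ Y) Y
─-disjoint X Y (v , v∈) with x∈p∩q⁻ (X ─ Y) Y v∈
... | v∈X─Y , v∈Y = x∈p─q⇒x∉q X Y v∈X─Y v∈Y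

-- Posimodularity of the cut function.

lookup-─ : ∀ {n} (X Y : Subset n) v → lookup (X ─ Y) v ≡ lookup X v ∧ not (lookup Y v)
lookup-─ (x ∷ X) (true  ∷ Y) zero    = sym (∧-zeroʳ x)
lookup-─ (x ∷ X) (false ∷ Y) zero    = sym (∧-identityʳ x)
lookup-─ (x ∷ X) (y ∷ Y)     (suc v) = lookup-─ X Y v

-- A counter step. `tally 0` is the 0/1 value of a Boolean; general `k` is the running count when
-- the edges of a cut are counted by a fold.
tally : ℕ → Bool → ℕ
tally k b = ifᵇ b then suc k else k

∣∷∣ : ∀ {n} b (X : Subset n) → ∣ b ∷ X ∣ ≡ tally 0 b + ∣ X ∣
∣∷∣ false X = refl
∣∷∣ true  X = refl

-- Reduces an inequality between cut sizes to a check on a single edge.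
∣map∣-mono : ∀ {A : Set} {m} (f g h k : A → Bool) →
             (∀ x → tally 0 (f x) + tally 0 (g x) ≤ tally 0 (h x) + tally 0 (k x)) →
             (xs : Vec A m) → ∣ map f xs ∣ + ∣ map g xs ∣ ≤ ∣ map h xs ∣ + ∣ map k xs ∣
∣map∣-mono f g h k le []       = z≤n
∣map∣-mono f g h k le (x ∷ xs) = begin
  ∣ f x ∷ map f xs ∣ + ∣ g x ∷ map g xs ∣                             ≡⟨ split f g ⟩
  (tally 0 (f x) + tally 0 (g x)) + (∣ map f xs ∣ + ∣ map g xs ∣)     ≤⟨ +-mono-≤ (le x) (∣map∣-mono f g h k le xs) ⟩
  (tally 0 (h x) + tally 0 (k x)) + (∣ map h xs ∣ + ∣ map k xs ∣)     ≡⟨ split h k ⟨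
  ∣ h x ∷ map h xs ∣ + ∣ k x ∷ map k xs ∣                             ∎
  where
  open ≤-Reasoning
  split : ∀ f g → ∣ f x ∷ map f xs ∣ + ∣ g x ∷ map g xs ∣ ≡
                  (tally 0 (f x) + tally 0 (g x)) + (∣ map f xs ∣ + ∣ map g xs ∣)
  split f g = trans (cong₂ _+_ (∣∷∣ (f x) (map f xs)) (∣∷∣ (g x) (map g xs)))
                    (interchange +-commutativeSemigroup (tally 0 (f x)) _ (tally 0 (g x)) _)

-- Once the membership of both ends is fixed, both sides are numerals. The inequality is strict only
-- for an edge between `X ∩ Y` and the outside of both sets, which counts 0 on the left and 2 on the
-- right.
edge-posimodular : ∀ xᵤ xᵥ yᵤ yᵥ →
  tally 0 ((xᵤ ∧ not yᵤ) xor (xᵥ ∧ not yᵥ)) + tally 0 ((yᵤ ∧ not xᵤ) xor (yᵥ ∧ not xᵥ)) ≤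
  tally 0 (xᵤ xor xᵥ) + tally 0 (yᵤ xor yᵥ)
edge-posimodular true  true  true  true  = ≤ᵇ⇒≤ _ _ tt
edge-posimodular true  true  true  false = ≤ᵇ⇒≤ _ _ tt
edge-posimodular true  true  false true  = ≤ᵇ⇒≤ _ _ tt
edge-posimodular true  true  false false = ≤ᵇ⇒≤ _ _ tt
edge-posimodular true  false true  true  = ≤ᵇ⇒≤ _ _ tt
edge-posimodular true  false true  false = ≤ᵇ⇒≤ _ _ tt
edge-posimodular true  false false true  = ≤ᵇ⇒≤ _ _ tt
edge-posimodular true  false false false = ≤ᵇ⇒≤ _ _ tt
edge-posimodular false true  true  true  = ≤ᵇ⇒≤ _ _ tt
edge-posimodular false true  true  false = ≤ᵇ⇒≤ _ _ tt
edge-posimodular false true  false true  = ≤ᵇ⇒≤ _ _ tt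
edge-posimodular false true  false false = ≤ᵇ⇒≤ _ _ tt
edge-posimodular false false true  true  = ≤ᵇ⇒≤ _ _ tt
edge-posimodular false false true  false = ≤ᵇ⇒≤ _ _ tt
edge-posimodular false false false true  = ≤ᵇ⇒≤ _ _ tt
edge-posimodular false false false false = ≤ᵇ⇒≤ _ _ tt

d-posimodular : ∀ G (X Y : VertexSet G) → d G (X ─ Y) + d G (Y ─ X) ≤ d G X + d G Y
d-posimodular G X Y = ∣map∣-mono _ _ _ _
  (λ (u , v) → subst₂ (λ a b → tally 0 a + tally 0 b ≤
                                 tally 0 (lookup X u xor lookup X v) + tally 0 (lookup Y u xor lookup Y v))
    (sym (cong₂ _xor_ (lookup-─ X Y u) (lookup-─ X Y v)))
    (sym (cong₂ _xor_ (lookup-─ Y X u) (lookup-─ Y X v)))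
    (edge-posimodular (lookup X u) (lookup X v) (lookup Y u) (lookup Y v)))
  (ends G)

-- The algorithm on sets of vertices.

uncross : ∀ G → VertexSet G → VertexSet G → VertexSet G × VertexSet G
uncross G X Y = ifᵇ d G (X ─ Y) ≤ᵇ d G X then (X ─ Y , Y) else (X , Y ─ X)

collect : ∀ {A : Set} → A × List A → List A
collect (x , xs) = x ∷ xs

-- The accumulator holds what is left of the new set, which travels on to the next member, and the
-- members already uncrossed with it, in reverse order.
insertStep : ∀ G → VertexSet G × List (VertexSet G) → VertexSet G → VertexSet G × List (VertexSet G)
insertStep G (X , D) Y = let (X′ , Y′) = uncross G X Y in X′ , Y′ ∷ D

insert : ∀ G → List (VertexSet G) → VertexSet G → List (VertexSet G)
insert G D X = collect (foldl (insertStep G) (X , []) D)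

-- Uncrossing can empty a set, for instance when a cluster is inserted twice, while the parts of a
-- `Partition` are nonempty.
keepNonempty : ∀ {n} → List (Subset n) → Subset n → List (Subset n)
keepNonempty Xs X = ifᵇ does (nonempty? X) then X ∷ Xs else Xs

disjointify : ∀ G → List (VertexSet G) → List (VertexSet G)
disjointify G Xs = foldl keepNonempty [] (foldl (insert G) [] Xs)

-- Invariants of insertion.

module _ (G : Graph) where

  uncross-⊆ : ∀ X Y → let (X′ , Y′) = uncross G X Y in X′ ⊆ X × Y′ ⊆ Y
  uncross-⊆ X Y with d G (X ─ Y) ≤ᵇ d G X
  ... | true  = p─q⊆p X Y , λ v∈ → v∈
  ... | false = (λ v∈ → v∈) , p─q⊆p Y X

  uncross-disjoint : ∀ X Y → uncurry Disjoint (uncross G X Y)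
  uncross-disjoint X Y with d G (X ─ Y) ≤ᵇ d G X
  ... | true  = ─-disjoint X Y
  ... | false = disjoint-sym {X = Y ─ X} (─-disjoint Y X)

  -- Only vertices of `X ∩ Y` are removed from one of the sets, and the other set keeps them.
  uncross-covers : ∀ X Y {v} → v ∈ X ⊎ v ∈ Y → let (X′ , Y′) = uncross G X Y in v ∈ X′ ⊎ v ∈ Y′
  uncross-covers X Y {v} v∈ with d G (X ─ Y) ≤ᵇ d G X | v∈ | v ∈? X | v ∈? Y
  ... | true  | _        | _      | yes v∈Y = inj₂ v∈Y
  ... | true  | inj₁ v∈X | _      | no v∉Y  = inj₁ (x∈p∧x∉q⇒x∈p─q v∈X v∉Y)
  ... | true  | inj₂ v∈Y | _      | no v∉Y  = contradiction v∈Y v∉Y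
  ... | false | _        | yes v∈X | _      = inj₁ v∈X
  ... | false | inj₁ v∈X | no v∉X | _       = contradiction v∈X v∉X
  ... | false | inj₂ v∈Y | no v∉X | _       = inj₂ (x∈p∧x∉q⇒x∈p─q v∈Y v∉X)

  -- The current set `X` may still meet the unprocessed `Ys`. Each step separates it from one more
  -- of them, and later shrinking cannot undo this.
  foldl-insertStep-disjoint :
    ∀ {X D} Ys → AllPairs Disjoint (X ∷ D) → AllPairs Disjoint Ys → All (λ Y → All (Disjoint Y) D) Ys →
    AllPairs Disjoint (collect (foldl (insertStep G) (X , D) Ys))
  foldl-insertStep-disjoint []       XD! _ _ = XD!
  foldl-insertStep-disjoint {X} {D} (Y ∷ Ys) (X#D ∷ D!) (Y#Ys ∷ Ys!) (Y#D ∷ Ys#D) with uncross-⊆ X Y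
  ... | X′⊆X , Y′⊆Y = foldl-insertStep-disjoint Ys
    ((uncross-disjoint X Y ∷ All.map (disjoint-⊆ X′⊆X (λ v∈ → v∈)) X#D) ∷
     All.map (disjoint-⊆ Y′⊆Y (λ v∈ → v∈)) Y#D ∷ D!)
    Ys!
    (All.zipWith
      (λ {Z} (Y#Z , Z#D) → disjoint-⊆ {X = Z} (λ v∈ → v∈) Y′⊆Y (disjoint-sym {X = Y} Y#Z) ∷ Z#D)
      (Y#Ys , Ys#D))

  foldl-insertStep-covers :
    ∀ {X D v} Ys → Any (v ∈_) (X ∷ D) ⊎ Any (v ∈_) Ys →
    Any (v ∈_) (collect (foldl (insertStep G) (X , D) Ys))
  foldl-insertStep-covers []       (inj₁ v∈) = v∈
  foldl-insertStep-covers {X} {D} {v} (Y ∷ Ys) v∈ = foldl-insertStep-covers Ys (step v∈)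
    where
    fromPair : v ∈ X ⊎ v ∈ Y → Any (v ∈_) (collect (insertStep G (X , D) Y)) ⊎ Any (v ∈_) Ys
    fromPair v∈ = inj₁ ([ here , (λ v∈Y′ → there (here v∈Y′)) ]′ (uncross-covers X Y v∈))

    step : Any (v ∈_) (X ∷ D) ⊎ Any (v ∈_) (Y ∷ Ys) →
           Any (v ∈_) (collect (insertStep G (X , D) Y)) ⊎ Any (v ∈_) Ys
    step (inj₁ (here v∈X))  = fromPair (inj₁ v∈X)
    step (inj₁ (there v∈D)) = inj₁ (there (there v∈D))
    step (inj₂ (here v∈Y))  = fromPair (inj₂ v∈Y)
    step (inj₂ (there v∈Ys)) = inj₂ v∈Ys

  foldl-insert-disjoint : ∀ {D} Xs → AllPairs Disjoint D → AllPairs Disjoint (foldl (insert G) D Xs)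
  foldl-insert-disjoint []       D! = D!
  foldl-insert-disjoint {D} (X ∷ Xs) D! =
    foldl-insert-disjoint Xs (foldl-insertStep-disjoint D ([] ∷ []) D! (All.universal (λ _ → []) D))

  foldl-insert-covers : ∀ {D v} Xs → Any (v ∈_) D ⊎ Any (v ∈_) Xs → Any (v ∈_) (foldl (insert G) D Xs)
  foldl-insert-covers []       (inj₁ v∈) = v∈
  foldl-insert-covers {D} (X ∷ Xs) (inj₁ v∈D) =
    foldl-insert-covers Xs (inj₁ (foldl-insertStep-covers D (inj₂ v∈D)))
  foldl-insert-covers {D} (X ∷ Xs) (inj₂ (here v∈X)) =
    foldl-insert-covers Xs (inj₁ (foldl-insertStep-covers D (inj₁ (here v∈X))))
  foldl-insert-covers {D} (X ∷ Xs) (inj₂ (there v∈Xs)) =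
    foldl-insert-covers Xs (inj₂ v∈Xs)

  module _ {μ : VertexSet G → ℕ} {p q : ℕ} (μ-mono : Monotone μ) where

    Cluster : VertexSet G → Set
    Cluster = IsCluster G μ p q

    uncross-clusters : ∀ X Y → Cluster X → Cluster Y → let (X′ , Y′) = uncross G X Y in Cluster X′ × Cluster Y′
    uncross-clusters X Y (μX≤p , dX≤q) (μY≤p , dY≤q) with d G (X ─ Y) ≤ᵇ d G X in eq
    ... | true  = (≤-trans (μ-mono _ _ (p─q⊆p X Y)) μX≤p ,
                   ≤-trans (≤ᵇ⇒≤ _ _ (subst T (sym eq) tt)) dX≤q) ,
                  (μY≤p , dY≤q)
    ... | false = (μX≤p , dX≤q) ,
                  (≤-trans (μ-mono _ _ (p─q⊆p Y X)) μY≤p ,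
                   -- The failed test gives `d X ≤ d (X ─ Y)`, so posimodularity yields
                   -- `d X + d (Y ─ X) ≤ d X + d Y`, where `d X` cancels.
                   ≤-trans (+-cancelˡ-≤ (d G X) _ _
                     (≤-trans (+-monoˡ-≤ (d G (Y ─ X)) dX≤) (d-posimodular G X Y))) dY≤q)
      where
      dX≤ : d G X ≤ d G (X ─ Y)
      dX≤ = <⇒≤ (≰⇒> (λ le → subst T eq (≤⇒≤ᵇ le)))

    foldl-insertStep-clusters : ∀ {X D} Ys → All Cluster (X ∷ D) → All Cluster Ys →
                                All Cluster (collect (foldl (insertStep G) (X , D) Ys))
    foldl-insertStep-clusters []       ks _ = ks
    foldl-insertStep-clusters {X} (Y ∷ Ys) (kX ∷ kD) (kY ∷ kYs) with uncross-clusters X Y kX kY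
    ... | kX′ , kY′ = foldl-insertStep-clusters Ys (kX′ ∷ kY′ ∷ kD) kYs

    foldl-insert-clusters : ∀ {D} Xs → All Cluster D → All Cluster Xs → All Cluster (foldl (insert G) D Xs)
    foldl-insert-clusters []       kD _ = kD
    foldl-insert-clusters {D} (X ∷ Xs) kD (kX ∷ kXs) =
      foldl-insert-clusters Xs (foldl-insertStep-clusters D (kX ∷ []) kD) kXs

-- Discarding the empty sets.

module _ {n : ℕ} where

  -- The conditional hypothesis covers two uses: `P` may be nonemptiness itself, or a property such
  -- as being a cluster that all sets of the list already have.
  foldl-keepNonempty-All : ∀ {P : Subset n → Set} {D} Xs → All P D → All (λ X → Nonempty X → P X) Xs →
                           All P (foldl keepNonempty D Xs)
  foldl-keepNonempty-All []       pD _ = pD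
  foldl-keepNonempty-All (X ∷ Xs) pD (pX ∷ pXs) with nonempty? X
  ... | yes X≠∅ = foldl-keepNonempty-All Xs (pX X≠∅ ∷ pD) pXs
  ... | no _    = foldl-keepNonempty-All Xs pD pXs

  foldl-keepNonempty-disjoint :
    ∀ {D : List (Subset n)} Xs → AllPairs Disjoint D → AllPairs Disjoint Xs → All (λ X → All (Disjoint X) D) Xs →
    AllPairs Disjoint (foldl keepNonempty D Xs)
  foldl-keepNonempty-disjoint []       D! _ _ = D!
  foldl-keepNonempty-disjoint (X ∷ Xs) D! (X#Xs ∷ Xs!) (X#D ∷ Xs#D) with does (nonempty? X)
  ... | false = foldl-keepNonempty-disjoint Xs D! Xs! Xs#D
  ... | true  = foldl-keepNonempty-disjoint Xs (X#D ∷ D!) Xs!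
    (All.zipWith (λ (X#Y , Y#D) → disjoint-sym {X = X} X#Y ∷ Y#D) (X#Xs , Xs#D))

  foldl-keepNonempty-covers : ∀ {D : List (Subset n)} {v} Xs → Any (v ∈_) D ⊎ Any (v ∈_) Xs →
                              Any (v ∈_) (foldl keepNonempty D Xs)
  foldl-keepNonempty-covers [] (inj₁ v∈D) = v∈D
  foldl-keepNonempty-covers (X ∷ Xs) v∈ with nonempty? X | v∈
  ... | yes _   | inj₁ v∈D          = foldl-keepNonempty-covers Xs (inj₁ (there v∈D))
  ... | yes _   | inj₂ (here v∈X)   = foldl-keepNonempty-covers Xs (inj₁ (here v∈X))
  ... | no _    | inj₁ v∈D          = foldl-keepNonempty-covers Xs (inj₁ v∈D)
  ... | no X=∅  | inj₂ (here v∈X)   = contradiction (_ , v∈X) X=∅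
  ... | _       | inj₂ (there v∈Xs) = foldl-keepNonempty-covers Xs (inj₂ v∈Xs)

disjointify-partition : ∀ G {μ p q} → Monotone μ → (Xs : List (VertexSet G)) → All (IsCluster G μ p q) Xs →
                        Covers Xs → Partition G μ p q
disjointify-partition G μ-mono Xs kXs cover = record
  -- Exactly the list that the program computes, so its output will agree with the encoded partition
  -- by `refl`.
  { parts    = disjointify G Xs
  ; nonempty = foldl-keepNonempty-All D [] (All.universal (λ _ X≠∅ → X≠∅) D)
  ; disjoint = foldl-keepNonempty-disjoint D [] (foldl-insert-disjoint G Xs []) (All.universal (λ _ → []) D)
  ; covering = ⊆-antisym ⊆⊤ (λ {v} _ →
      ∈-⋃⁺ (foldl-keepNonempty-covers D (inj₂ (foldl-insert-covers G Xs (inj₂ (cover v))))))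
  ; clusters = foldl-keepNonempty-All D [] (All.map (λ k _ → k) (foldl-insert-clusters G μ-mono Xs [] kXs))
  }
  where
  D : List (VertexSet G)
  D = foldl (insert G) [] Xs

-- Polynomial time bounds

infixl 6 _⊕_
infixl 7 _⊗_

data Poly : Set where
  con     : ℕ → Poly
  𝕩       : Poly
  _⊕_ _⊗_ : Poly → Poly → Poly

⟦_⟧ : Poly → ℕ → ℕ
⟦ con k ⟧ n = k
⟦ 𝕩 ⟧     n = n
⟦ P ⊕ Q ⟧ n = ⟦ P ⟧ n + ⟦ Q ⟧ n
⟦ P ⊗ Q ⟧ n = ⟦ P ⟧ n * ⟦ Q ⟧ n

-- For a sum both exponents are raised to `b + b′`, which needs a positive `n`; the size of a tree
-- is always positive.
monomial-bound : ∀ P → ∃ λ a → ∃ λ b → ∀ n .{{_ : NonZero n}} → ⟦ P ⟧ n ≤ a * n ^ b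
monomial-bound (con k) = k , 0 , λ n → ≤-reflexive (sym (*-identityʳ k))
monomial-bound 𝕩 = 1 , 1 , λ n → ≤-reflexive (sym (trans (*-identityˡ (n ^ 1)) (^-identityʳ n)))
monomial-bound (P ⊕ Q) with monomial-bound P | monomial-bound Q
... | a , b , P≤ | a′ , b′ , Q≤ = a + a′ , b + b′ , λ n → begin
  ⟦ P ⟧ n + ⟦ Q ⟧ n                      ≤⟨ +-mono-≤ (P≤ n) (Q≤ n) ⟩
  a * n ^ b + a′ * n ^ b′                ≤⟨ +-mono-≤ (*-monoʳ-≤ a (^-monoʳ-≤ n (m≤m+n b b′)))
                                                     (*-monoʳ-≤ a′ (^-monoʳ-≤ n (m≤n+m b′ b))) ⟩
  a * n ^ (b + b′) + a′ * n ^ (b + b′)   ≡⟨ *-distribʳ-+ (n ^ (b + b′)) a a′ ⟨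
  (a + a′) * n ^ (b + b′)                ∎
  where open ≤-Reasoning
monomial-bound (P ⊗ Q) with monomial-bound P | monomial-bound Q
... | a , b , P≤ | a′ , b′ , Q≤ = a * a′ , b + b′ , λ n → begin
  ⟦ P ⟧ n * ⟦ Q ⟧ n              ≤⟨ *-mono-≤ (P≤ n) (Q≤ n) ⟩
  (a * n ^ b) * (a′ * n ^ b′)    ≡⟨ [m*n]*[o*p]≡[m*o]*[n*p] a (n ^ b) a′ (n ^ b′) ⟩
  (a * a′) * (n ^ b * n ^ b′)    ≡⟨ cong (a * a′ *_) (^-distribˡ-+-* n b b′) ⟨
  (a * a′) * n ^ (b + b′)        ∎
  where open ≤-Reasoning

-- Hiding the exact running time behind a bound lets runs whose time depends on the data share one
-- polynomial.
record Halts {k} (N : ℕ) (c : Cmd k) (σ τ : Store k) (P : Poly) : Set where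
  constructor halts
  field
    {time} : ℕ
    run    : c ⊢ σ ⇓[ time ] τ
    bound  : time ≤ ⟦ P ⟧ N

open Halts

halts-≔ : ∀ {k N} {x : Fin k} {e σ} → Halts N (x ≔ e) σ (σ [ x ]≔ eval e σ) (con (1 + cost e))
halts-≔ = halts assign ≤-refl

halts-⨾ : ∀ {k N} {c c′ : Cmd k} {σ τ υ P Q} → Halts N c σ τ P → Halts N c′ τ υ Q →
          Halts N (c ⨾ c′) σ υ (con 1 ⊕ (P ⊕ Q))
halts-⨾ (halts r r≤) (halts r′ r′≤) = halts (seq r r′) (s≤s (+-mono-≤ r≤ r′≤))

-- Programs with a stack

pattern top   = zero
pattern stack = suc zero

it : Expr 1
it = var zero

-- Expressions in a `Code` see only `top`, so they cannot disturb the stack; hence `Runs` can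
-- quantify over every stack.
lift : Expr 1 → Expr 2
lift (var zero)  = var top
lift nil         = nil
lift (cons e e′) = cons (lift e) (lift e′)
lift (hd e)      = hd (lift e)
lift (tl e)      = tl (lift e)

eval-lift : ∀ e {x s} → eval (lift e) (x ∷ s ∷ []) ≡ eval e (x ∷ [])
eval-lift (var zero)  = refl
eval-lift nil         = refl
eval-lift (cons e e′) = cong₂ _∙_ (eval-lift e) (eval-lift e′)
eval-lift (hd e)      = cong head (eval-lift e)
eval-lift (tl e)      = cong tail (eval-lift e)

infixr 5 _⟫_

-- Programs computing functions of one tree, the value in the variable `top`.
-- If c computes f, then `call e c` replaces the value x by f (e x) ∙ x, and
-- `fold c` replaces b ∙ xs by the left fold of f over the list xs.
data Code : Set where
  set    : Expr 1 → Code
  _⟫_    : Code → Code → Code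
  call   : Expr 1 → Code → Code
  branch : Expr 1 → Code → Code → Code
  fold   : Code → Code

-- Running `c` overwrites `top`, so `call` and `fold` first push the old value on the stack and
-- later take from it what is still required.
compile : Code → Cmd 2
compile (set e)         = top ≔ lift e
compile (c ⟫ c′)        = compile c ⨾ compile c′
compile (call e c)      =
  stack ≔ cons (var top) (var stack) ⨾
  top ≔ lift e ⨾
  compile c ⨾
  top ≔ cons (var top) (hd (var stack)) ⨾
  stack ≔ tl (var stack)
compile (branch e c c′) = if lift e then compile c else compile c′
compile (fold c)        =
  (while tl (var top) loop
    (stack ≔ cons (var top) (var stack) ⨾
     top ≔ cons (hd (var top)) (hd (tl (var top))) ⨾
     compile c ⨾
     -- The saved value is `b ∙ x ∙ xs`, from which the remaining list `xs` is recovered.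
     top ≔ cons (var top) (tl (tl (hd (var stack)))) ⨾
     stack ≔ tl (var stack))) ⨾
  top ≔ hd (var top)

-- The bound is a formal polynomial in N, so that in statements of the form ∃ λ P → …
-- below unification finds it. In these N is at least the number of vertices, edges and sets.
record Runs (N : ℕ) (c : Code) (x y : Tree) (P : Poly) : Set where
  field
    onStack : ∀ s → Halts N (compile c) (x ∷ s ∷ []) (y ∷ s ∷ []) P

open Runs

module _ {N : ℕ} where

  runs-≡ : ∀ {c x y z P} → y ≡ z → Runs N c x y P → Runs N c x z P
  runs-≡ refl r = r

  runs-set : ∀ {e x} → Runs N (set e) x (eval e (x ∷ [])) (con (1 + cost (lift e)))
  runs-set {e} {x} .onStack s =
    subst (λ y → Halts N (compile (set e)) _ (y ∷ s ∷ []) _) (eval-lift e) halts-≔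

  runs-⨾ : ∀ {c c′ x y z P Q} → Runs N c x y P → Runs N c′ y z Q →
           Runs N (c ⟫ c′) x z (con 1 ⊕ (P ⊕ Q))
  runs-⨾ r r′ .onStack s = halts-⨾ (r .onStack s) (r′ .onStack s)

  runs-call : ∀ {e c x y P} → Runs N c (eval e (x ∷ [])) y P →
              Runs N (call e c) x (y ∙ x) _
  runs-call {e} r .onStack s =
    halts-⨾ halts-≔ (halts-⨾ (runs-set {e} .onStack _) (halts-⨾ (r .onStack _) (halts-⨾ halts-≔ halts-≔)))

  -- The sum `P ⊕ Q` stands in for a maximum. Each branch may assume the value of the condition, so
  -- a branch that cannot be taken is dismissed by `λ ()`.
  runs-branch : ∀ {e c c′ x y P Q} b → truth (eval e (x ∷ [])) ≡ b →
                (b ≡ true → Runs N c x y P) → (b ≡ false → Runs N c′ x y Q) →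
                Runs N (branch e c c′) x y (con (1 + cost (lift e)) ⊕ (P ⊕ Q))
  runs-branch {e} {P = P} {Q} true eq r r′ .onStack s with r refl .onStack s
  ... | halts p p≤ = halts (if-true (trans (cong truth (eval-lift e)) eq) p)
                           (+-monoʳ-≤ (1 + cost (lift e)) (≤-trans p≤ (m≤m+n (⟦ P ⟧ N) (⟦ Q ⟧ N))))
  runs-branch {e} {P = P} {Q} false eq r r′ .onStack s with r′ refl .onStack s
  ... | halts p p≤ = halts (if-false (trans (cong truth (eval-lift e)) eq) p)
                           (+-monoʳ-≤ (1 + cost (lift e)) (≤-trans p≤ (m≤n+m (⟦ Q ⟧ N) (⟦ P ⟧ N))))

  -- The test `tl (var top)` costs 2 and the loop itself 1: this is the 3 in every round and the 3
  -- of the last, failing test. The invariant also sees the entries still to come.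
  halts-while :
    ∀ {A B : Set} {c s Q} (encA : A → Tree) (encB : B → Tree) (f : B → A → B) (I : B → List A → Set) →
    (∀ b x xs → I b (x ∷ xs) →
      Halts N c ((encB b ∙ encodeList encA (x ∷ xs)) ∷ s ∷ []) ((encB (f b x) ∙ encodeList encA xs) ∷ s ∷ []) Q ×
      I (f b x) xs) →
    ∀ b xs → I b xs →
    Halts N (while tl (var top) loop c) ((encB b ∙ encodeList encA xs) ∷ s ∷ []) ((encB (foldl f b xs) ∙ nil) ∷ s ∷ [])
      (con (length xs) ⊗ (con 3 ⊕ Q) ⊕ con 3)
  halts-while encA encB f I step b []       i = halts (while-false refl) ≤-refl
  halts-while {Q = Q} encA encB f I step b (x ∷ xs) i with step b x xs i
  ... | halts r r≤ , i′ with halts-while encA encB f I step (f b x) xs i′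
  ... | halts r′ r′≤ = halts (while-true refl r r′)
    (≤-trans (+-monoʳ-≤ 3 (+-mono-≤ r≤ r′≤)) (≤-reflexive (sym (+-assoc (3 + ⟦ Q ⟧ N) _ 3))))

  -- Replacing the number of rounds by `𝕩` makes the bound independent of the list.
  halts-length : ∀ {k} {c : Cmd k} {σ τ n Q R} → n ≤ N →
                 Halts N c σ τ (con n ⊗ Q ⊕ R) → Halts N c σ τ (𝕩 ⊗ Q ⊕ R)
  halts-length {Q = Q} {R} n≤N (halts r r≤) =
    halts r (≤-trans r≤ (+-monoˡ-≤ (⟦ R ⟧ N) (*-monoˡ-≤ (⟦ Q ⟧ N) n≤N)))

  -- A single `P` must bound all rounds, although the accumulator may grow; the invariant is what
  -- controls its size.
  runs-fold-invariant :
    ∀ {A B : Set} {c P} (encA : A → Tree) (encB : B → Tree) (f : B → A → B) (I : B → List A → Set) →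
    (∀ b x xs → I b (x ∷ xs) → Runs N c (encB b ∙ encA x) (encB (f b x)) P × I (f b x) xs) →
    ∀ {b xs} → I b xs → length xs ≤ N →
    Runs N (fold c) (encB b ∙ encodeList encA xs) (encB (foldl f b xs)) _
  runs-fold-invariant encA encB f I step {b} {xs} i l .onStack s =
    halts-⨾ (halts-length l (halts-while encA encB f I
      (λ b x xs i → halts-⨾ halts-≔ (halts-⨾ halts-≔ (halts-⨾ (step b x xs i .proj₁ .onStack _)
                      (halts-⨾ halts-≔ halts-≔)))
                  , step b x xs i .proj₂)
      b xs i)) halts-≔

  runs-fold :
    ∀ {A B : Set} {c P} (encA : A → Tree) (encB : B → Tree) (f : B → A → B) →
    (∀ b x → Runs N c (encB b ∙ encA x) (encB (f b x)) P) →
    ∀ {b xs} → length xs ≤ N →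
    Runs N (fold c) (encB b ∙ encodeList encA xs) (encB (foldl f b xs)) _
  runs-fold encA encB f step =
    runs-fold-invariant encA encB f (λ _ _ → ⊤) (λ b x _ _ → step b x , tt) tt

-- The uncrossing program

dropCode memberCode crossCode degreeCode differenceCode uncrossCode insertCode emptyTestCode partitionCode : Code

-- Takes one tail for each unit of a unary number. On a list this leads to an entry; on another
-- unary number it is truncated subtraction.
dropCode = fold (set (tl (hd it)))

memberCode = dropCode ⟫ set (hd it)

-- Before the branch the value is `b ∙ a ∙ X ∙ u ∙ v`, where `a` and `b` tell whether `u` and `v`
-- lie in `X`; the branches form `a xor b`.
crossCode =
  call (cons (hd it) (hd (tl it))) memberCode ⟫
  call (cons (hd (tl it)) (tl (tl (tl it)))) memberCode ⟫
  branch (hd (tl it))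
    (branch (hd it) (set nil) (set (cons nil nil)))
    (set (hd it))

-- The body of a fold sees only the accumulator and one entry, so `X` is carried in the accumulator
-- beside the unary count.
degreeCode =
  set (cons (cons (hd it) nil) (tl it)) ⟫
  fold
    (call (cons (hd (hd it)) (tl it)) crossCode ⟫
     branch (hd it)
       (set (cons (hd (hd (tl it))) (cons nil (tl (hd (tl it))))))
       (set (hd (tl it)))) ⟫
  set (tl it)

-- The first fold runs along `X`, consumes `Y` inside the accumulator and builds the result
-- backwards; the second fold reverses it.
differenceCode =
  set (cons (cons (tl it) nil) (hd it)) ⟫
  fold
    (branch (hd (hd (hd it)))
      (set (cons (tl (hd (hd it))) (cons nil (tl (hd it)))))
      (set (cons (tl (hd (hd it))) (cons (tl it) (tl (hd it)))))) ⟫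
  set (cons nil (tl it)) ⟫
  fold (set (cons (tl it) (hd it)))

-- Before the branch the value is r ∙ d (X ─ Y) ∙ d X ∙ (X ─ Y) ∙ E ∙ X ∙ Y, where E is
-- the list of edges and r = (d X + 1) ∸ d (X ─ Y) is true iff d (X ─ Y) ≤ d X.
uncrossCode =
  call (tl it) differenceCode ⟫
  call (cons (hd (tl (tl it))) (hd (tl it))) degreeCode ⟫
  call (cons (hd (tl it)) (hd (tl (tl it)))) degreeCode ⟫
  call (cons (cons nil (hd (tl it))) (hd it)) dropCode ⟫
  branch (hd it)
    (set (cons (hd rest) (tl (tl (tl rest)))))
    (call (cons (tl (tl (tl rest))) (hd (tl (tl rest)))) differenceCode ⟫
     set (cons (hd (tl (tl rest′))) (hd it)))
  where
  rest rest′ : Expr 1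
  rest  = tl (tl (tl it))
  -- The `call` has put one more entry in front, so this denotes what `rest` denoted before it.
  rest′ = tl rest

-- The accumulator is `E ∙ X ∙ D`. Since a nonempty list is encoded as its head paired with its
-- tail, the final value already reads as `E` with the list `X ∷ D`, which realises `collect`.
insertCode =
  set (cons (cons (hd (hd it)) (cons (tl it) nil)) (tl (hd it))) ⟫
  fold
    (call (cons (hd (hd it)) (cons (hd (tl (hd it))) (tl it))) uncrossCode ⟫
     set (cons (hd (hd (tl it))) (cons (hd (hd it)) (cons (tl (hd it)) (tl (tl (hd (tl it))))))))

-- A disjunction over the characteristic vector: the answer is true for a nonempty set.
emptyTestCode = fold (branch (tl it) (set (tl it)) (set (hd it)))

partitionCode =
  set (cons (cons (tl (hd it)) nil) (tl it)) ⟫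
  fold insertCode ⟫
  set (cons nil (tl it)) ⟫
  fold
    (call (cons nil (tl it)) emptyTestCode ⟫
     branch (hd it)
       (set (cons (tl (tl it)) (hd (tl it))))
       (set (hd (tl it))))

-- Correctness and running time of the programs.

encodePair : ∀ {A B : Set} → (A → Tree) → (B → Tree) → A × B → Tree
encodePair f g (x , y) = f x ∙ g y

encodeEdges : ∀ {n} → List (Fin n × Fin n) → Tree
encodeEdges = encodeList (λ (u , v) → encodeℕ (toℕ u) ∙ encodeℕ (toℕ v))

truth-encodeBool : ∀ b → truth (encodeBool b) ≡ b
truth-encodeBool false = refl
truth-encodeBool true  = refl

-- A unary number is the code of a list of units, so `fold` can iterate over it.
encodeℕ-replicate : ∀ n → encodeList (λ (_ : ⊤) → nil) (replicate n tt) ≡ encodeℕ n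
encodeℕ-replicate zero    = refl
encodeℕ-replicate (suc n) = cong (nil ∙_) (encodeℕ-replicate n)

tails : ℕ → Tree → Tree
tails zero    t = t
tails (suc n) t = tails n (tail t)

foldl-tail : ∀ n t → foldl (λ t (_ : ⊤) → tail t) t (replicate n tt) ≡ tails n t
foldl-tail zero    t = refl
foldl-tail (suc n) t = foldl-tail n (tail t)

-- `P` is chosen before `N` and the data, which makes the bound uniform; the same holds for the
-- other programs.
dropCode-runs : ∃ λ P → ∀ {N n t} → n ≤ N → Runs N dropCode (t ∙ encodeℕ n) (tails n t) P
dropCode-runs = _ , λ {N} {n} {t} n≤N →
  subst₂ (λ x y → Runs N dropCode (t ∙ x) y _) (encodeℕ-replicate n) (foldl-tail n t)
    (runs-fold _ (λ t → t) _ (λ _ _ → runs-set) (subst (_≤ N) (sym (length-replicate n)) n≤N))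

tails-∸ : ∀ m n → tails n (encodeℕ m) ≡ encodeℕ (m ∸ n)
tails-∸ m       zero    = refl
tails-∸ zero    (suc n) = trans (tails-∸ zero n) (cong encodeℕ (0∸n≡0 n))
tails-∸ (suc m) (suc n) = tails-∸ m n

head-tails-lookup : ∀ {n} (X : Subset n) v → head (tails (toℕ v) (encodeSubset X)) ≡ encodeBool (lookup X v)
head-tails-lookup (b ∷ X) zero    = refl
head-tails-lookup (b ∷ X) (suc v) = head-tails-lookup X v

memberCode-runs : ∃ λ P → ∀ {N n} {X : Subset n} {v} → n ≤ N →
                  Runs N memberCode (encodeSubset X ∙ encodeℕ (toℕ v)) (encodeBool (lookup X v)) P
memberCode-runs = _ , λ {_} {_} {X} {v} n≤N →
  runs-≡ (head-tails-lookup X v)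
    (runs-⨾ (dropCode-runs .proj₂ (≤-trans (<⇒≤ (toℕ<n v)) n≤N)) runs-set)

crossCode-runs : ∃ λ P → ∀ {N n} {X : Subset n} {u v} → n ≤ N →
                 Runs N crossCode (encodeSubset X ∙ (encodeℕ (toℕ u) ∙ encodeℕ (toℕ v)))
                      (encodeBool (lookup X u xor lookup X v)) P
crossCode-runs = _ , λ {_} {_} {X} {u} {v} n≤N →
  runs-⨾ (runs-call (memberCode-runs .proj₂ n≤N))
  (runs-⨾ (runs-call (memberCode-runs .proj₂ n≤N))
  (runs-branch (lookup X u) (truth-encodeBool _)
    (λ u∈X → runs-branch (lookup X v) (truth-encodeBool _)
      (λ v∈X → runs-≡ (cong₂ (λ a b → encodeBool (a xor b)) (sym u∈X) (sym v∈X)) runs-set)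
      (λ v∉X → runs-≡ (cong₂ (λ a b → encodeBool (a xor b)) (sym u∈X) (sym v∉X)) runs-set))
    (λ u∉X → runs-≡ (cong (λ a → encodeBool (a xor lookup X v)) (sym u∉X)) runs-set)))

foldl-tally : ∀ {A : Set} {n} (f : A → Bool) (xs : Vec A n) k →
              foldl (λ k x → tally k (f x)) k (toList xs) ≡ ∣ map f xs ∣ + k
foldl-tally f []       k = refl
foldl-tally f (x ∷ xs) k with f x
... | false = foldl-tally f xs k
... | true  = trans (foldl-tally f xs (suc k)) (+-suc _ k)

degreeCode-runs : ∃ λ P → ∀ {N} G {X : VertexSet G} → order G ≤ N → size G ≤ N →
                  Runs N degreeCode (encodeSubset X ∙ encodeEdges (toList (ends G))) (encodeℕ (d G X)) P
degreeCode-runs = _ , λ {N} G {X} n≤N m≤N →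
  let crosses : Fin (order G) × Fin (order G) → Bool
      crosses (u , v) = lookup X u xor lookup X v
  in
  runs-≡ (cong encodeℕ (trans (foldl-tally crosses (ends G) 0) (+-identityʳ _)))
  (runs-⨾ runs-set
  (runs-⨾ (runs-fold _ (λ k → encodeSubset X ∙ encodeℕ k) (λ k e → tally k (crosses e))
    (λ k e →
      runs-⨾ (runs-call (crossCode-runs .proj₂ n≤N))
      (runs-branch (crosses e) (truth-encodeBool _)
        (λ eq → runs-≡ (cong (λ b → encodeSubset X ∙ encodeℕ (tally k b)) (sym eq)) runs-set)
        (λ eq → runs-≡ (cong (λ b → encodeSubset X ∙ encodeℕ (tally k b)) (sym eq)) runs-set)))
    (subst (_≤ N) (sym (length-toList (ends G))) m≤N))
  runs-set))

encodeBools : List Bool → Tree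
encodeBools = encodeList encodeBool

-- The first clause follows the program when `ys` has run out: the head of `nil` is `nil`, which
-- reads as false.
subtract : List Bool × List Bool → Bool → List Bool × List Bool
subtract ([]         , zs) x = [] , x ∷ zs
subtract (true  ∷ ys , zs) x = ys , false ∷ zs
subtract (false ∷ ys , zs) x = ys , x ∷ zs

foldl-subtract : ∀ {n} (X Y : Subset n) zs →
                 foldl subtract (toList Y , zs) (toList X) ≡ ([] , toList (X ─ Y) ʳ++ zs)
foldl-subtract []      []          zs = refl
foldl-subtract (x ∷ X) (true  ∷ Y) zs = foldl-subtract X Y (false ∷ zs)
foldl-subtract (x ∷ X) (false ∷ Y) zs = foldl-subtract X Y (x ∷ zs)

differenceCode-runs : ∃ λ P → ∀ {N n} {X Y : Subset n} → n ≤ N →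
                      Runs N differenceCode (encodeSubset X ∙ encodeSubset Y) (encodeSubset (X ─ Y)) P
differenceCode-runs = _ , λ {N} {_} {X} {Y} n≤N →
  runs-⨾ runs-set
  (runs-⨾ (runs-≡ (cong (encodePair encodeBools encodeBools) (foldl-subtract X Y []))
    (runs-fold encodeBool (encodePair encodeBools encodeBools) subtract subtract-runs
      (subst (_≤ N) (sym (length-toList X)) n≤N)))
  (runs-⨾ runs-set
  (runs-≡ (cong encodeBools (trans (ʳ++-ʳ++ (toList (X ─ Y))) (++-identityʳ _)))
    (runs-fold encodeBool encodeBools (flip _∷_) (λ _ _ → runs-set)
      (subst (_≤ N) (sym (trans (length-ʳ++ (toList (X ─ Y))) (trans (+-identityʳ _) (length-toList (X ─ Y))))) n≤N)))))
  where
  subtract-runs : ∀ {N} b x →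
    Runs N _ (encodePair encodeBools encodeBools b ∙ encodeBool x)
             (encodePair encodeBools encodeBools (subtract b x)) _
  subtract-runs ([]         , zs) x = runs-branch false refl (λ ()) (λ _ → runs-set)
  subtract-runs (true  ∷ ys , zs) x = runs-branch true  refl (λ _ → runs-set) (λ ())
  subtract-runs (false ∷ ys , zs) x = runs-branch false refl (λ ()) (λ _ → runs-set)

truth-encodeℕ-∸ : ∀ m n → truth (encodeℕ (suc n ∸ m)) ≡ (m ≤ᵇ n)
truth-encodeℕ-∸ zero          n       = refl
truth-encodeℕ-∸ (suc zero)    zero    = refl
truth-encodeℕ-∸ (suc (suc m)) zero    = refl
truth-encodeℕ-∸ (suc m)       (suc n) = trans (truth-encodeℕ-∸ m n) (≤ᵇ-suc m n)
  where
  ≤ᵇ-suc : ∀ m n → (m ≤ᵇ n) ≡ (suc m ≤ᵇ suc n)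
  ≤ᵇ-suc zero    n = refl
  ≤ᵇ-suc (suc m) n = refl

module _ (G : Graph) where

  edges : Tree
  edges = encodeEdges (toList (ends G))

  encodeSubsets : List (VertexSet G) → Tree
  encodeSubsets = encodeList encodeSubset

  encodeTwo : VertexSet G × VertexSet G → Tree
  encodeTwo = encodePair encodeSubset encodeSubset

uncrossCode-runs : ∃ λ P → ∀ {N} G {X Y : VertexSet G} → order G ≤ N → size G ≤ N →
                   Runs N uncrossCode (edges G ∙ (encodeSubset X ∙ encodeSubset Y)) (encodeTwo G (uncross G X Y)) P
uncrossCode-runs = _ , λ {N} G {X} {Y} n≤N m≤N →
  runs-⨾ (runs-call (differenceCode-runs .proj₂ n≤N))
  (runs-⨾ (runs-call (degreeCode-runs .proj₂ G n≤N m≤N))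
  (runs-⨾ (runs-call (degreeCode-runs .proj₂ G n≤N m≤N))
  (runs-⨾ (runs-call (runs-≡ (tails-∸ (suc (d G X)) (d G (X ─ Y))) 
            -- The number dropped is a degree, hence at most the number of edges.
            (dropCode-runs .proj₂ (≤-trans (∣p∣≤n (Δ G (X ─ Y))) m≤N))))
  (runs-branch (d G (X ─ Y) ≤ᵇ d G X) (truth-encodeℕ-∸ (d G (X ─ Y)) (d G X))
    (λ eq → runs-≡ (cong (λ b → encodeTwo G (ifᵇ b then (X ─ Y , Y) else (X , Y ─ X))) (sym eq)) runs-set)
    (λ eq → runs-≡ (cong (λ b → encodeTwo G (ifᵇ b then (X ─ Y , Y) else (X , Y ─ X))) (sym eq))
      (runs-⨾ (runs-call (differenceCode-runs .proj₂ n≤N)) runs-set))))))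

insertCode-runs : ∃ λ P → ∀ {N} G {X} {D : List (VertexSet G)} → order G ≤ N → size G ≤ N → length D ≤ N →
                  Runs N insertCode ((edges G ∙ encodeSubsets G D) ∙ encodeSubset X)
                       (edges G ∙ encodeSubsets G (insert G D X)) P
insertCode-runs = _ , λ {N} G n≤N m≤N D≤N →
  runs-⨾ runs-set
  (runs-fold encodeSubset (λ acc → edges G ∙ encodePair encodeSubset (encodeSubsets G) acc) (insertStep G)
    (λ _ _ → runs-⨾ (runs-call (uncrossCode-runs .proj₂ G n≤N m≤N)) runs-set)
    D≤N)

does-nonempty?-outside : ∀ {n} (X : Subset n) → does (nonempty? X) ≡ does (nonempty? (false ∷ X))
does-nonempty?-outside X = does-⇔
  (mk⇔ (λ (v , v∈) → suc v , there v∈) λ { (zero , ()) ; (suc v , v∈) → v , drop-there v∈ })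
  (nonempty? X) (nonempty? (false ∷ X))

foldl-∨ : ∀ {n} a (X : Subset n) → foldl _∨_ a (toList X) ≡ a ∨ does (nonempty? X)
foldl-∨ a []          = sym (∨-identityʳ a)
foldl-∨ a (true  ∷ X) = trans (foldl-∨ (a ∨ true) X) (∨-assoc a true _)
foldl-∨ a (false ∷ X) =
  trans (foldl-∨ (a ∨ false) X) (trans (∨-assoc a false _) (cong (a ∨_) (does-nonempty?-outside X)))

emptyTestCode-runs : ∃ λ P → ∀ {N n} {X : Subset n} → n ≤ N →
                     Runs N emptyTestCode (nil ∙ encodeSubset X) (encodeBool (does (nonempty? X))) P
emptyTestCode-runs = _ , λ {N} {_} {X} n≤N →
  runs-≡ (cong encodeBool (foldl-∨ false X))
    (runs-fold encodeBool encodeBool _∨_ or-runs (subst (_≤ N) (sym (length-toList X)) n≤N))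
  where
  or-runs : ∀ {N} a b → Runs N _ (encodeBool a ∙ encodeBool b) (encodeBool (a ∨ b)) _
  or-runs a     true  = runs-branch true  refl (λ _ → runs-≡ (cong encodeBool (sym (∨-zeroʳ a))) runs-set) (λ ())
  or-runs a     false = runs-branch false refl (λ ()) (λ _ → runs-≡ (cong encodeBool (sym (∨-identityʳ a))) runs-set)

-- Bounds the family by the number of sets inserted so far; sets that became empty still count,
-- being discarded only at the end.
length-insert : ∀ G (D : List (VertexSet G)) X → length (insert G D X) ≡ suc (length D)
length-insert G D X = cong suc (trans (go D (X , [])) (+-identityʳ _))
  where
  go : ∀ D acc → length (proj₂ (foldl (insertStep G) acc D)) ≡ length D + length (proj₂ acc)
  go []      acc = refl
  go (Y ∷ D) acc = trans (go D (insertStep G acc Y)) (+-suc (length D) _)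

partitionCode-runs : ∃ λ P → ∀ {N} G {Xs : List (VertexSet G)} → order G ≤ N → size G ≤ N → length Xs ≤ N →
                     Runs N partitionCode (encodeGraph G ∙ encodeSubsets G Xs) (encodeSubsets G (disjointify G Xs)) P
partitionCode-runs = _ , λ {N} G {Xs} n≤N m≤N l≤N →
  runs-⨾ runs-set
  (runs-⨾ (runs-fold-invariant encodeSubset (λ D → edges G ∙ encodeSubsets G D) (insert G)
    -- Each insertion moves one set from the list to the family, so the sum is constant and bounds
    -- the length of `D` in every round.
    (λ D Xs → length D + length Xs ≤ N)
    (λ D X Xs D+Xs≤N →
      insertCode-runs .proj₂ G n≤N m≤N (m+n≤o⇒m≤o (length D) D+Xs≤N) ,
      subst (_≤ N) (trans (+-suc (length D) (length Xs)) (cong (_+ length Xs) (sym (length-insert G D X)))) D+Xs≤N)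
    l≤N l≤N)
  (runs-⨾ runs-set
  (runs-fold encodeSubset (encodeSubsets G) keepNonempty
    (λ D X → runs-⨾ (runs-call (emptyTestCode-runs .proj₂ n≤N))
      (runs-branch (does (nonempty? X)) (truth-encodeBool _)
        (λ eq → runs-≡ (cong (λ b → encodeSubsets G (ifᵇ b then X ∷ D else D)) (sym eq)) runs-set)
        (λ eq → runs-≡ (cong (λ b → encodeSubsets G (ifᵇ b then X ∷ D else D)) (sym eq)) runs-set)))
    (length-disjoint G Xs l≤N))))
  where
  length-disjoint : ∀ {N} G Xs → length Xs ≤ N → length (foldl (insert G) [] Xs) ≤ N
  length-disjoint G Xs = subst (_≤ _) (sym (trans (go Xs []) (+-identityʳ _)))
    where
    go : ∀ Xs D → length (foldl (insert G) D Xs) ≡ length Xs + length D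
    go []       D = refl
    go (X ∷ Xs) D = trans (go Xs (insert G D X)) (trans (cong (length Xs +_) (length-insert G D X)) (+-suc _ _))

-- Size of the encoded instance, and the theorem.

length≤∥encodeList∥ : ∀ {A : Set} (f : A → Tree) xs → length xs ≤ ∥ encodeList f xs ∥
length≤∥encodeList∥ f []       = z≤n
length≤∥encodeList∥ f (x ∷ xs) = s≤s (≤-trans (length≤∥encodeList∥ f xs) (m≤n+m _ ∥ f x ∥))

n≤∥encodeℕ∥ : ∀ n → n ≤ ∥ encodeℕ n ∥
n≤∥encodeℕ∥ zero    = z≤n
n≤∥encodeℕ∥ (suc n) = s≤s (≤-trans (n≤∥encodeℕ∥ n) (n≤1+n _))

∥left∥≤ : ∀ l r → ∥ l ∥ ≤ ∥ l ∙ r ∥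
∥left∥≤ l r = m≤n⇒m≤1+n (m≤m+n ∥ l ∥ ∥ r ∥)

∥right∥≤ : ∀ l r → ∥ r ∥ ≤ ∥ l ∙ r ∥
∥right∥≤ l r = m≤n⇒m≤1+n (m≤n+m ∥ r ∥ ∥ l ∥)

order≤∥encodeGraph∥ : ∀ G → order G ≤ ∥ encodeGraph G ∥
order≤∥encodeGraph∥ G = ≤-trans (n≤∥encodeℕ∥ (order G)) (∥left∥≤ _ (edges G))

size≤∥encodeGraph∥ : ∀ G → size G ≤ ∥ encodeGraph G ∥
size≤∥encodeGraph∥ G = ≤-trans (≤-reflexive (sym (length-toList (ends G))))
  (≤-trans (length≤∥encodeList∥ _ (toList (ends G))) (∥right∥≤ (encodeℕ (order G)) _))

lemma1 : ((G : Graph) (p q : ℕ) (μ : VertexSet G → ℕ) → Monotone μ →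
    (∀ (v : Fin (order G)) → ∃ λ C → IsCluster G μ p q C × v ∈ C) →
    Partition G μ p q)
    × SolvableInPolyTime ClusterCover encodeCover PartitionOf encodePartition
lemma1 = partition , program , coefficient , exponent , solve
  where
  partition : (G : Graph) (p q : ℕ) (μ : VertexSet G → ℕ) → Monotone μ →
              (∀ (v : Fin (order G)) → ∃ λ C → IsCluster G μ p q C × v ∈ C) →
              Partition G μ p q
  partition G p q μ μ-mono cluster = disjointify-partition G μ-mono
    -- One cluster for each vertex; repetitions are harmless.
    (tabulate (λ v → cluster v .proj₁))
    (All.tabulate⁺ (λ v → cluster v .proj₂ .proj₁))
    (λ v → Any.tabulate⁺ v (cluster v .proj₂ .proj₂))

  program : Program
  program = record { vars = 2 ; read = top ; body = compile partitionCode ; write = top }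

  P = proj₁ partitionCode-runs

  coefficient exponent : ℕ
  coefficient = monomial-bound P .proj₁
  exponent    = monomial-bound P .proj₂ .proj₁

  solve : ∀ I → ∃ λ S → ∃ λ t →
          Computes program (encodeCover I) t (encodePartition I S) ×
          t ≤ coefficient * ∥ encodeCover I ∥ ^ exponent + coefficient
  solve I =
    disjointify-partition graph monotone sets clusters (λ v → ∈-⋃⁻ sets (subst (v ∈_) (sym covering) ∈⊤)) ,
    h .time , (_ , h .run , refl) ,
    ≤-trans (h .bound) (≤-trans (monomial-bound P .proj₂ .proj₂ ∥ encodeCover I ∥) (m≤m+n _ coefficient))
    where
    open ClusterCover I
    encodedSets = encodeSubsets graph sets
    graph≤ = ∥left∥≤ (encodeGraph graph) encodedSets

    -- `N` is the size of the whole encoded instance, which bounds the numbers of vertices, edges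
    -- and sets.
    h = partitionCode-runs .proj₂ {∥ encodeCover I ∥} graph {sets}
      (≤-trans (order≤∥encodeGraph∥ graph) graph≤)
      (≤-trans (size≤∥encodeGraph∥ graph) graph≤)
      (≤-trans (length≤∥encodeList∥ encodeSubset sets) (∥right∥≤ (encodeGraph graph) encodedSets))
      -- The stack starts as `nil`, like every variable other than the input.
      .onStack nil
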